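{- For every integer $n\ge1$, $$\sum_{\substack{\mathbf w\in \mathrm{PF}_n\\ \mathrm{pk}(\mathbf w)=0\\ \mathrm{tie}(\mathbf w)=0}}t^{\mathrm{des}(\mathbf w)}=\sum_{j=0}^{n-1}\frac1n\binom nj\binom n{j+1}t^j.$$
   Context: A parking function of length $n$ is a word $\mathbf w=(w_1,\dots,w_n)\in[n]^n$, $[n]=\{1,\dots,n\}$, whose nondecreasing rearrangement $b_1\le\dots\le b_n$ satisfies $b_i\le i$ for all $i$; $\mathrm{PF}_n$ is the set of these. For a word $\mathbf w$ of length $n$: $\mathrm{des}(\mathbf w)$ is the number of $i\in[n-1]$ with $w_i>w_{i+1}$; $\mathrm{tie}(\mathbf w)$ is the number of $i\in[n-1]$ with $w_i=w_{i+1}$; $\mathrm{pk}(\mathbf w)$ is the number of indices $2\le i\le n-1$ with $w_{i-1}<w_i>w_{i+1}$. -}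

module Defs where

open import Data.Bool.Base using (if_then_else_)
open import Data.Fin.Base using (Fin; toℕ)
open import Data.Fin.Properties using (all?)
open import Data.List.Base
  using (List; []; _∷_; _++_; length; lookup; map; foldr; filter; replicate;
         applyUpTo; cartesianProductWith)
open import Data.Nat.Base as ℕ using (ℕ; zero; suc; _≤_)
open import Data.Nat.Properties using (_≤?_; _<?_; ≤-decTotalOrder)
import Data.Nat.Properties as ℕ
open import Data.List.Sort.InsertionSort ≤-decTotalOrder using (sort)
open import Data.Product.Base using (_×_)
open import Data.Rational.Base using (ℚ; 0ℚ; _+_)
open import Relation.Binary.PropositionalEquality.Core using (_≡_)
open import Relation.Nullary.Decidable.Core using (Dec; does; _×-dec_)
open import Relation.Unary using (Decidable)

Word : Set
Word = List ℕ

𝟙 : ∀ {p} {P : Set p} → Dec P → ℕ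
𝟙 P? = if does P? then 1 else 0

des : Word → ℕ
des []          = 0
des (x ∷ [])    = 0
des (x ∷ y ∷ w) = 𝟙 (y <? x) ℕ.+ des (y ∷ w)

tie : Word → ℕ
tie []          = 0
tie (x ∷ [])    = 0
tie (x ∷ y ∷ w) = 𝟙 (x ℕ.≟ y) ℕ.+ tie (y ∷ w)

pk : Word → ℕ
pk []              = 0
pk (x ∷ [])        = 0
pk (x ∷ y ∷ [])    = 0
pk (x ∷ y ∷ z ∷ w) = 𝟙 ((x <? y) ×-dec (z <? y)) ℕ.+ pk (y ∷ z ∷ w)

-- [ n ] lists 1, …, n, and words k n lists each element of [n]ᵏ exactly once.
[_] : ℕ → List ℕ
[ n ] = applyUpTo suc n

words : ℕ → ℕ → List Word
words zero    n = [] ∷ []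
words (suc k) n = cartesianProductWith _∷_ [ n ] (words k n)

-- Positions in a list are numbered from 0, hence bᵢ ≤ i reads with suc.
Parking : Word → Set
Parking w = (i : Fin (length (sort w))) → lookup (sort w) i ≤ suc (toℕ i)

parking? : Decidable Parking
parking? w = all? λ i → lookup (sort w) i ≤? suc (toℕ i)

PF : ℕ → List Word
PF n = filter parking? (words n n)

PeakAndTieFree : Word → Set
PeakAndTieFree w = pk w ≡ 0 × tie w ≡ 0

peakAndTieFree? : Decidable PeakAndTieFree
peakAndTieFree? w = (pk w ℕ.≟ 0) ×-dec (tie w ℕ.≟ 0)

-- Polynomials in t over ℚ, as lists of coefficients with the constant term
-- first.  Trailing zeros are allowed, so equality is the relation _≈_ below.
ℚ[t] : Set
ℚ[t] = List ℚ

coeff : ℚ[t] → ℕ → ℚ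
coeff []      k       = 0ℚ
coeff (a ∷ p) zero    = a
coeff (a ∷ p) (suc k) = coeff p k

infix 4 _≈_
_≈_ : ℚ[t] → ℚ[t] → Set
p ≈ q = ∀ k → coeff p k ≡ coeff q k

infixl 6 _⊕_
_⊕_ : ℚ[t] → ℚ[t] → ℚ[t]
[]      ⊕ q       = q
(a ∷ p) ⊕ []      = a ∷ p
(a ∷ p) ⊕ (b ∷ q) = a + b ∷ p ⊕ q

infix 8 _·t^_
_·t^_ : ℚ → ℕ → ℚ[t]
c ·t^ d = replicate d 0ℚ ++ c ∷ []

∑ : ∀ {a} {A : Set a} → List A → (A → ℚ[t]) → ℚ[t]
∑ xs f = foldr _⊕_ [] (map f xs)

{-# OPTIONS --safe #-}
module Submission where

-- A word without peaks and ties decreases strictly to its minimum and then increases strictly.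
-- If it is a parking function of length n = M + 1, its minimum is 1, so it is determined by the
-- sets L, R ⊆ {2, …, n} of the letters on the two sides of the 1; it has |L| descents, and it
-- parks iff |L ∩ [v]| ≥ |Rᶜ ∩ [v]| for all v.  Adding the letters in increasing order makes
-- (L, Rᶜ) a ballot path, so by reflection there are C(M,k)² − C(M,k−1) C(M,k+1) such words with
-- k descents, which is the Narayana number.

open import Defs
open import Data.Nat.Base hiding (_/_)
open import Data.Nat.Properties
open import Data.Nat.Combinatorics using (_C_; nC1≡n; k>n⇒nCk≡0; nCk+nC[k+1]≡[n+1]C[k+1])
open import Data.Nat.Tactic.RingSolver using (solve-∀)
open import Data.Fin.Base using (zero; suc; toℕ)
open import Data.Fin.Properties using (toℕ<n)
open import Data.List.Base hiding ([_])
open import Data.List.Properties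
  using (length-map; length-++; filter-++; filter-accept; filter-reject; filter-all; filter-none; length-filter;
         ∷-injective; ∷-injectiveʳ; ∷ʳ-injectiveˡ; upTo-∷ʳ)
open import Data.List.Membership.Propositional using (_∈_)
open import Data.List.Membership.Propositional.Properties
  using (∈-map⁺; ∈-++⁺ˡ; ∈-++⁺ʳ; ∈-filter⁺; ∈-filter⁻; ∈-applyUpTo⁺; ∈-applyUpTo⁻;
         ∈-cartesianProductWith⁺; ∈-cartesianProductWith⁻)
open import Data.List.Membership.Propositional.Properties.WithK using (unique∧set⇒bag)
open import Data.List.Relation.Binary.BagAndSetEquality using (∼bag⇒↭)
open import Data.List.Relation.Binary.Disjoint.Propositional using (Disjoint)
open import Data.List.Relation.Binary.Permutation.Propositional using (_↭_)
open import Data.List.Relation.Binary.Permutation.Propositional.Properties using (↭-length; filter-↭)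
open import Data.List.Relation.Unary.All as All using (All; []; _∷_)
import Data.List.Relation.Unary.All.Properties as All
open import Data.List.Relation.Unary.AllPairs using (AllPairs; []; _∷_)
open import Data.List.Relation.Unary.Any using (here)
open import Data.List.Relation.Unary.Linked using (Linked; []; [-]; _∷_)
import Data.List.Relation.Unary.Linked.Properties as Linked
open import Data.List.Relation.Unary.Unique.Propositional using (Unique)
import Data.List.Relation.Unary.Unique.Propositional.Properties as Unique
open import Data.List.Sort.InsertionSort ≤-decTotalOrder using (sort)
open import Data.List.Sort.InsertionSort.Properties ≤-decTotalOrder using (sort-↭; sort-↗)
open import Data.Maybe.Base using (just)
open import Data.Maybe.Properties using (just-injective)
open import Data.Product.Base using (_×_; _,_; proj₁; proj₂)
open import Data.Sum.Base using (inj₁; inj₂)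
open import Function.Base using (_∘_)
open import Function.Bundles using (mk⇔)
open import Relation.Binary.Definitions using (tri<; tri≈; tri>)
open import Relation.Binary.PropositionalEquality hiding ([_])
open import Relation.Nullary.Decidable.Core using (Dec; yes; no; _×-dec_)
open import Relation.Nullary.Negation.Core using (¬_; contradiction)

-- Removing the largest letter shortens a word by 0, 1 or 2 while the alphabet shrinks by 1, so an
-- induction on letters leaves the parking functions. It runs instead over words on [M + 1] of
-- length M + 1 + h, where h = |L| - |Rᶜ| is the current height of the ballot path and j = |Rᶜ|;
-- parking functions are the paths that end at h = 0. The ballot condition is built in by taking h
-- in ℕ. The list `gen` builds these words from the four ways in which the next letter can enter. It
-- is matched with the filtered list of all words through equal membership and absence of
-- repetitions, so no map between words and pairs of sets is constructed. Nor are paths reflected: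
-- the determinant C(M, j+h) C(M, j) - C(M, j+h+1) C(M, j-1) is checked against the four-term
-- recursion.

private variable
  P : Set
  x y M N h i j l v k n : ℕ
  w : Word

-- Words without peaks and ties

𝟙≡0⇒¬ : (P? : Dec P) → 𝟙 P? ≡ 0 → ¬ P
𝟙≡0⇒¬ (no ¬p) _ = ¬p

¬⇒𝟙≡0 : (P? : Dec P) → ¬ P → 𝟙 P? ≡ 0
¬⇒𝟙≡0 (yes p) ¬p = contradiction p ¬p
¬⇒𝟙≡0 (no _)  _  = refl

⇒𝟙≡1 : (P? : Dec P) → P → 𝟙 P? ≡ 1
⇒𝟙≡1 (yes _) _ = refl
⇒𝟙≡1 (no ¬p) p = contradiction p ¬p

-- Each `falling` accounts for exactly one descent and `rising` for none, so induction on this type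
-- keeps track of `des`.
data Valley : Word → Set where
  rising  : Linked _<_ w → Valley w
  falling : y < x → Valley (y ∷ w) → Valley (x ∷ y ∷ w)

pk-tail : ∀ w → pk (x ∷ w) ≡ 0 → pk w ≡ 0
pk-tail []          _  = refl
pk-tail (_ ∷ [])    _  = refl
pk-tail {x} (y ∷ z ∷ w) eq = m+n≡0⇒n≡0 (𝟙 ((x <? y) ×-dec (z <? y))) eq

-- After an ascent to `y`, an equal letter would be a tie and a smaller one would make `y` a peak.
ascent⇒rising : ∀ w → x < y → pk (x ∷ y ∷ w) ≡ 0 → tie (y ∷ w) ≡ 0 → Linked _<_ (x ∷ y ∷ w)
ascent⇒rising [] x<y _ _ = x<y ∷ [-]
ascent⇒rising {x} {y} (z ∷ w) x<y pk≡0 tie≡0 with <-cmp y z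
... | tri< y<z _ _ = x<y ∷ ascent⇒rising w y<z (pk-tail (y ∷ z ∷ w) pk≡0) (m+n≡0⇒n≡0 (𝟙 (y ≟ z)) tie≡0)
... | tri≈ _ y≡z _ = contradiction y≡z (𝟙≡0⇒¬ (y ≟ z) (m+n≡0⇒m≡0 _ tie≡0))
... | tri> _ _ z<y = contradiction (x<y , z<y) (𝟙≡0⇒¬ ((x <? y) ×-dec (z <? y)) (m+n≡0⇒m≡0 _ pk≡0))

valley-∷ : ∀ x y w → PeakAndTieFree (x ∷ y ∷ w) → Valley (y ∷ w) → Valley (x ∷ y ∷ w)
valley-∷ x y w (pk≡0 , tie≡0) v with <-cmp x y
... | tri< x<y _ _ = rising (ascent⇒rising w x<y pk≡0 (m+n≡0⇒n≡0 (𝟙 (x ≟ y)) tie≡0))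
... | tri≈ _ x≡y _ = contradiction x≡y (𝟙≡0⇒¬ (x ≟ y) (m+n≡0⇒m≡0 _ tie≡0))
... | tri> _ _ y<x = falling y<x v

valley⁺ : ∀ w → PeakAndTieFree w → Valley w
valley⁺ []          _                  = rising []
valley⁺ (_ ∷ [])    _                  = rising [-]
valley⁺ (x ∷ y ∷ w) f@(pk≡0 , tie≡0) =
  valley-∷ x y w f (valley⁺ (y ∷ w) (pk-tail (y ∷ w) pk≡0 , m+n≡0⇒n≡0 (𝟙 (x ≟ y)) tie≡0))

rising⇒pk≡0 : Linked _<_ w → pk w ≡ 0
rising⇒pk≡0 []                  = refl
rising⇒pk≡0 [-]                 = refl
rising⇒pk≡0 (_ ∷ [-])           = refl
rising⇒pk≡0 {x ∷ y ∷ z ∷ w} (_ ∷ l@(y<z ∷ _)) =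
  cong₂ _+_ (¬⇒𝟙≡0 ((x <? y) ×-dec (z <? y)) (<-asym y<z ∘ proj₂)) (rising⇒pk≡0 l)

rising⇒tie≡0 : Linked _<_ w → tie w ≡ 0
rising⇒tie≡0 []  = refl
rising⇒tie≡0 [-] = refl
rising⇒tie≡0 {x ∷ y ∷ _} (x<y ∷ l) = cong₂ _+_ (¬⇒𝟙≡0 (x ≟ y) (<⇒≢ x<y)) (rising⇒tie≡0 l)

valley⁻ : Valley w → PeakAndTieFree w
valley⁻ (rising l) = rising⇒pk≡0 l , rising⇒tie≡0 l
valley⁻ {x ∷ y ∷ []} (falling y<x _) = refl , cong (_+ 0) (¬⇒𝟙≡0 (x ≟ y) (>⇒≢ y<x))
valley⁻ {x ∷ y ∷ z ∷ w} (falling y<x v) =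
  cong₂ _+_ (¬⇒𝟙≡0 ((x <? y) ×-dec (z <? y)) (<-asym y<x ∘ proj₁)) (proj₁ (valley⁻ v)) ,
  cong₂ _+_ (¬⇒𝟙≡0 (x ≟ y) (>⇒≢ y<x)) (proj₂ (valley⁻ v))

valley-tail : Valley (x ∷ w) → Valley w
valley-tail (rising [-])     = rising []
valley-tail (rising (_ ∷ l)) = rising l
valley-tail (falling _ v)    = v

rising-∷ʳ⁺ : Linked _<_ w → All (_< x) w → Linked _<_ (w ∷ʳ x)
rising-∷ʳ⁺ []        []           = [-]
rising-∷ʳ⁺ [-]       (y<x ∷ [])   = y<x ∷ [-]
rising-∷ʳ⁺ (z<y ∷ l) (_ ∷ w<x)    = z<y ∷ rising-∷ʳ⁺ l w<x

valley-∷ʳ⁺ : Valley w → All (_< x) w → Valley (w ∷ʳ x)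
valley-∷ʳ⁺ (rising l)      w<x       = rising (rising-∷ʳ⁺ l w<x)
valley-∷ʳ⁺ (falling y<z v) (_ ∷ w<x) = falling y<z (valley-∷ʳ⁺ v w<x)

rising-∷ʳ⁻ : ∀ w → Linked _<_ (w ∷ʳ x) → Linked _<_ w
rising-∷ʳ⁻ []          _         = []
rising-∷ʳ⁻ (_ ∷ [])    _         = [-]
rising-∷ʳ⁻ (_ ∷ _ ∷ w) (y<z ∷ l) = y<z ∷ rising-∷ʳ⁻ (_ ∷ w) l

valley-∷ʳ⁻ : ∀ w → Valley (w ∷ʳ x) → Valley w
valley-∷ʳ⁻ []          _               = rising []
valley-∷ʳ⁻ (_ ∷ [])    _               = rising [-]
valley-∷ʳ⁻ (_ ∷ _ ∷ w) (rising l)      = rising (rising-∷ʳ⁻ _ l)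
valley-∷ʳ⁻ (_ ∷ _ ∷ w) (falling y<z v) = falling y<z (valley-∷ʳ⁻ (_ ∷ w) v)

des-∷ʳ : All (_< x) w → des (w ∷ʳ x) ≡ des w
des-∷ʳ []                  = refl
des-∷ʳ {x} {y ∷ []} (y<x ∷ []) = cong (_+ 0) (¬⇒𝟙≡0 (x <? y) (<-asym y<x))
des-∷ʳ {x} {y ∷ z ∷ w} (_ ∷ w<x) = cong (𝟙 (z <? y) +_) (des-∷ʳ w<x)

des-falling : ∀ w → y < x → des (x ∷ y ∷ w) ≡ suc (des (y ∷ w))
des-falling {y} {x} w y<x = cong (_+ des (y ∷ w)) (⇒𝟙≡1 (y <? x) y<x)

rising-length : All (_≤ N) (x ∷ w) → Linked _<_ (x ∷ w) → length w + x ≤ N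
rising-length (x≤N ∷ []) [-] = x≤N
rising-length {x = x} (_ ∷ w≤N@(_∷_ {xs = w} _ _)) (x<y ∷ l) =
  ≤-trans (≤-reflexive (sym (+-suc (length w) x)))
    (≤-trans (+-monoʳ-≤ (length w) x<y) (rising-length w≤N l))

-- The rising part has distinct letters from 1 to `N`, and each letter before it starts a descent.
-- This bound later shows that a letter missing from R is counted by `j`.
valley-length : All (1 ≤_) w → All (_≤ N) w → Valley w → length w ≤ N + des w
valley-length {[]} _ _ _ = z≤n
valley-length {x ∷ w} {N} (1≤x ∷ _) w≤N (rising l) = begin
  suc (length w)      ≡⟨ +-comm 1 (length w) ⟩
  length w + 1        ≤⟨ +-monoʳ-≤ (length w) 1≤x ⟩
  length w + x        ≤⟨ rising-length w≤N l ⟩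
  N                   ≤⟨ m≤m+n N _ ⟩
  N + des (x ∷ w)     ∎ where open ≤-Reasoning
valley-length {x ∷ y ∷ w} {N} (_ ∷ 1≤w) (_ ∷ w≤N) (falling y<x v) = begin
  suc (length (y ∷ w))                  ≤⟨ s≤s (valley-length 1≤w w≤N v) ⟩
  suc (N + des (y ∷ w))                 ≡⟨ +-suc N _ ⟨
  N + suc (des (y ∷ w))                 ≡⟨ cong (N +_) (des-falling w y<x) ⟨
  N + des (x ∷ y ∷ w)                   ∎ where open ≤-Reasoning

-- Positions of the largest letter

data Peelʳ (N : ℕ) : Word → Set where
  none  : All (_≤ N) w → Peelʳ N w
  right : All (_≤ N) w → Peelʳ N (w ∷ʳ suc N)

-- The cases record whether `suc N` lies in L and whether it lies in R. They exhaust the valleys,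
-- because an interior letter of a valley has a larger neighbour.
data Peel (N : ℕ) : Word → Set where
  none  : All (_≤ N) w → Peel N w
  right : All (_≤ N) w → Peel N (w ∷ʳ suc N)
  left  : All (_≤ N) w → Peel N (suc N ∷ w)
  both  : All (_≤ N) w → Peel N (suc N ∷ (w ∷ʳ suc N))

peelʳ-∷ : x ≤ N → Peelʳ N w → Peelʳ N (x ∷ w)
peelʳ-∷ x≤N (none w≤N)  = none (x≤N ∷ w≤N)
peelʳ-∷ x≤N (right w≤N) = right (x≤N ∷ w≤N)

peelʳ : x ≤ N → All (_≤ suc N) w → Valley (x ∷ w) → Peelʳ N (x ∷ w)
peelʳ x≤N [] _ = none (x≤N ∷ [])
peelʳ x≤N (_ ∷ w≤) (falling y<x v) = peelʳ-∷ x≤N (peelʳ (≤-trans (<⇒≤ y<x) x≤N) w≤ v)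
peelʳ x≤N (y≤ ∷ w≤) (rising (_ ∷ l)) with m≤n⇒m<n∨m≡n y≤ | l
... | inj₁ y≤N  | _         = peelʳ-∷ x≤N (peelʳ (s≤s⁻¹ y≤N) w≤ (rising l))
... | inj₂ refl | [-]       = right (x≤N ∷ [])
... | inj₂ refl | y<z ∷ _   = contradiction (All.head w≤) (<⇒≱ y<z)

peelʳ⇒peel : Peelʳ N w → Peel N w
peelʳ⇒peel (none w≤N)  = none w≤N
peelʳ⇒peel (right w≤N) = right w≤N

peel-∷ : Peelʳ N w → Peel N (suc N ∷ w)
peel-∷ (none w≤N)  = left w≤N
peel-∷ (right w≤N) = both w≤N

peel : All (_≤ suc N) w → Valley w → Peel N w
peel [] _ = none []
peel (x≤1+N ∷ w≤1+N) v with m≤n⇒m<n∨m≡n x≤1+N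
peel (_ ∷ w≤1+N)       v                  | inj₁ x<1+N = peelʳ⇒peel (peelʳ (s≤s⁻¹ x<1+N) w≤1+N v)
-- The one-letter word fits `left` and `right` alike; it is filed under `left`, where density will
-- exclude it.
peel (_ ∷ _)           (rising [-])       | inj₂ refl = left []
peel (_ ∷ w≤1+N)       (rising (x<y ∷ _)) | inj₂ refl = contradiction (All.head w≤1+N) (<⇒≱ x<y)
peel (_ ∷ _ ∷ w≤1+N)   (falling y<x v)    | inj₂ refl = peel-∷ (peelʳ (s≤s⁻¹ y<x) w≤1+N v)

-- The parking condition by counting, and its behaviour under a new largest letter

count≤ : ℕ → Word → ℕ
count≤ v w = length (filter (_≤? v) w)

-- In this form a new letter above the threshold changes nothing, wherever it is placed, and no
-- sorting has to be redone.
Dense : ℕ → Word → Set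
Dense M w = ∀ {v} → v ≤ suc M → v ≤ count≤ v w

count≤-∷ : v < x → count≤ v (x ∷ w) ≡ count≤ v w
count≤-∷ {v} v<x = cong length (filter-reject (_≤? v) (<⇒≱ v<x))

count≤-∷ʳ : ∀ w → v < x → count≤ v (w ∷ʳ x) ≡ count≤ v w
count≤-∷ʳ {v} {x} w v<x = begin
  count≤ v (w ∷ʳ x)                                          ≡⟨ cong length (filter-++ (_≤? v) w _) ⟩
  length (filter (_≤? v) w ++ filter (_≤? v) (x ∷ []))       ≡⟨ length-++ (filter (_≤? v) w) ⟩
  count≤ v w + count≤ v (x ∷ [])                             ≡⟨ cong (count≤ v w +_) (count≤-∷ v<x) ⟩
  count≤ v w + 0                                             ≡⟨ +-identityʳ _ ⟩
  count≤ v w                                                 ∎ where open ≡-Reasoning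

count≤-all : All (_≤ v) w → count≤ v w ≡ length w
count≤-all w≤v = cong length (filter-all (_≤? _) w≤v)

count≤-↭ : ∀ {w w′} → w ↭ w′ → count≤ v w ≡ count≤ v w′
count≤-↭ w↭w′ = ↭-length (filter-↭ (_≤? _) w↭w′)

length-∷ʳ : ∀ (w : Word) → length (w ∷ʳ x) ≡ suc (length w)
length-∷ʳ w = trans (length-++ w) (+-comm (length w) 1)

-- If L and R are the sets of letters left and right of the unique 1, then j + h = |L|, and
-- j is the number of elements of {2, …, M + 1} missing from R.
record Shape (M j h : ℕ) (w : Word) : Set where
  constructor shape
  field
    valley   : Valley w
    positive : All (1 ≤_) w
    bounded  : All (_≤ suc M) w
    dense    : Dense M w
    length≡  : length w ≡ suc M + h
    des≡     : des w ≡ j + h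

  bounded< : All (_< suc (suc M)) w
  bounded< = All.map s≤s bounded

  bounded⁺ : All (_≤ suc (suc M)) w
  bounded⁺ = All.map m≤n⇒m≤1+n bounded

-- The only new threshold is M + 2. There every letter counts, and the length M + 2 + h is enough
-- precisely because h ≥ 0.
dense⁺ : ∀ w {w′} → (∀ {v} → v ≤ suc M → count≤ v w′ ≡ count≤ v w) →
         All (_≤ suc (suc M)) w′ → length w′ ≡ suc (suc M) + h → Dense M w → Dense (suc M) w′
dense⁺ _ same w′≤ len dense v≤ with m≤n⇒m<n∨m≡n v≤
... | inj₁ v<   = subst (_ ≤_) (sym (same (s≤s⁻¹ v<))) (dense (s≤s⁻¹ v<))
... | inj₂ refl = subst (_ ≤_) (sym (trans (count≤-all w′≤) len)) (m≤m+n _ _)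

-- The word stays the same, but the absent letter joins Rᶜ: the height drops while |L| = j + h is
-- preserved.
shape-none : Shape M j (suc h) w → Shape (suc M) (suc j) h w
shape-none {M} {j} {h} {w} s = shape valley positive bounded⁺
  (dense⁺ w (λ _ → refl) bounded⁺ len dense) len (trans des≡ (+-suc j h))
  where
  open Shape s
  len : length w ≡ suc (suc M) + h
  len = trans length≡ (+-suc (suc M) h)

shape-right : Shape M j h w → Shape (suc M) j h (w ∷ʳ suc (suc M))
shape-right {M} {j} {h} {w} s = shape (valley-∷ʳ⁺ valley bounded<) (All.∷ʳ⁺ positive z<s) bound
  (dense⁺ w (λ v≤ → count≤-∷ʳ w (s≤s v≤)) bound len dense) len (trans (des-∷ʳ bounded<) des≡)
  where
  open Shape s
  bound = All.∷ʳ⁺ bounded⁺ ≤-refl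
  len : length (w ∷ʳ suc (suc M)) ≡ suc (suc M) + h
  len = trans (length-∷ʳ w) (cong suc length≡)

shape-left : Shape M j h w → Shape (suc M) (suc j) h (suc (suc M) ∷ w)
-- A letter put before the empty word would create no descent.
shape-left {w = []} s = contradiction (Shape.length≡ s) λ ()
shape-left {M} {j} {h} {w@(y ∷ u)} s = shape (falling y< valley) (z<s ∷ positive) bound
  (dense⁺ w (λ v≤ → count≤-∷ {w = w} (s≤s v≤)) bound len dense) len
  (trans (des-falling u y<) (cong suc des≡))
  where
  open Shape s
  y< = All.head bounded<
  bound = ≤-refl ∷ bounded⁺
  len : suc (length w) ≡ suc (suc M) + h
  len = cong suc length≡

shape-both : Shape M j h w → Shape (suc M) j (suc h) (suc (suc M) ∷ (w ∷ʳ suc (suc M)))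
shape-both {w = []} s = contradiction (Shape.length≡ s) λ ()
shape-both {M} {j} {h} {w@(y ∷ u)} s = shape
  (falling y< (valley-∷ʳ⁺ valley bounded<)) (z<s ∷ All.∷ʳ⁺ positive z<s) bound
  (dense⁺ w (λ v≤ → trans (count≤-∷ {w = w ∷ʳ _} (s≤s v≤)) (count≤-∷ʳ w (s≤s v≤))) bound len dense) len
  (trans (des-falling (u ∷ʳ _) y<) (trans (cong suc (trans (des-∷ʳ bounded<) des≡)) (sym (+-suc j h))))
  where
  open Shape s
  y< = All.head bounded<
  bound = ≤-refl ∷ All.∷ʳ⁺ bounded⁺ ≤-refl
  len : suc (length (w ∷ʳ suc (suc M))) ≡ suc (suc M) + suc h
  len = trans (cong suc (trans (length-∷ʳ w) (cong suc length≡))) (cong suc (sym (+-suc (suc M) h)))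

-- Enumeration letter by letter

delay : (ℕ → List Word) → ℕ → List Word
delay f zero    = []
delay f (suc k) = f k

prepend append surround : ℕ → Word → Word
prepend  x w = x ∷ w
append   x w = w ∷ʳ x
surround x w = x ∷ (w ∷ʳ x)

-- As used in `gen`, the first half holds the words that do not start with `x`, the second half
-- those that do; within each half the words ending in `x` come first. Uniqueness separates the
-- blocks in this order, and in the count the halves give Pascal's rule for |L|, the blocks within a
-- half that for |Rᶜ|.
module Extend (x : ℕ) (g : ℕ → ℕ → List Word) (j h : ℕ) where
  nones rights lefts boths extend : List Word
  nones  = delay (λ i → g i (suc h)) j
  rights = map (append x) (g j h)
  lefts  = delay (λ i → map (prepend x) (g i h)) j
  boths  = delay (λ l → map (surround x) (g j l)) h
  extend = (rights ++ nones) ++ (boths ++ lefts)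

gen : ℕ → ℕ → ℕ → List Word
gen zero    zero zero = (1 ∷ []) ∷ []
gen zero    _    _    = []
gen (suc M)           = Extend.extend (suc (suc M)) (gen M)

delay-all : ∀ {P : Word → Set} f k → (∀ i → k ≡ suc i → All P (f i)) → All P (delay f k)
delay-all f zero    p = []
delay-all f (suc k) p = p k refl

gen-sound : ∀ M j h → All (Shape M j h) (gen M j h)
gen-sound zero    zero    zero    =
  shape (rising [-]) (z<s ∷ []) (≤-refl ∷ []) (λ { z≤n → z≤n ; (s≤s z≤n) → s≤s z≤n }) refl refl ∷ []
gen-sound zero    zero    (suc _) = []
gen-sound zero    (suc _) _       = []
gen-sound (suc M) j       h       = All.++⁺
  (All.++⁺ (All.map⁺ (All.map shape-right (gen-sound M j h)))
           (delay-all _ j λ { i refl → All.map shape-none (gen-sound M i (suc h)) }))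
  (All.++⁺ (delay-all _ h λ { l refl → All.map⁺ (All.map shape-both (gen-sound M j l)) })
           (delay-all _ j λ { i refl → All.map⁺ (All.map shape-left (gen-sound M i h)) }))

-- Completeness of the enumeration

dense⁻ : ∀ w w′ → (∀ {v} → v ≤ suc M → count≤ v w′ ≡ count≤ v w) → Dense (suc M) w′ → Dense M w
dense⁻ _ _ same dense v≤ = subst (_ ≤_) (same v≤) (dense (m≤n⇒m≤1+n v≤))

dense⇒length : ∀ w → Dense M w → suc M ≤ length w
dense⇒length w dense = ≤-trans (dense ≤-refl) (length-filter (_≤? _) w)

unshape-none : All (_≤ suc M) w → Shape (suc M) (suc j) h w → Shape M j (suc h) w
unshape-none {M} {w} {j} {h} w≤ s = shape valley positive w≤ (dense⁻ w w (λ _ → refl) dense)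
  (trans length≡ (sym (+-suc (suc M) h))) (trans des≡ (sym (+-suc j h)))
  where open Shape s

unshape-right : All (_≤ suc M) w → Shape (suc M) j h (w ∷ʳ suc (suc M)) → Shape M j h w
unshape-right {M} {w} w≤ s = shape (valley-∷ʳ⁻ w valley) (proj₁ (All.∷ʳ⁻ positive)) w≤
  (dense⁻ w (w ∷ʳ _) (λ v≤ → count≤-∷ʳ w (s≤s v≤)) dense)
  (suc-injective (trans (sym (length-∷ʳ w)) length≡))
  (trans (sym (des-∷ʳ (All.map s≤s w≤))) des≡)
  where open Shape s

unshape-left : All (_≤ suc M) w → Shape (suc M) (suc j) h (suc (suc M) ∷ w) → Shape M j h w
unshape-left {M} {[]} w≤ s = contradiction (dense⇒length (suc (suc M) ∷ []) (Shape.dense s)) λ { (s≤s ()) }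
unshape-left {M} {w@(y ∷ u)} w≤ s = shape (valley-tail valley) (All.tail positive) w≤
  (dense⁻ w (suc (suc M) ∷ w) (λ v≤ → count≤-∷ {w = w} (s≤s v≤)) dense)
  (suc-injective length≡)
  (suc-injective (trans (sym (des-falling u (s≤s (All.head w≤)))) des≡))
  where open Shape s

dense-both : ∀ w → Dense (suc M) (surround (suc (suc M)) w) → Dense M w
dense-both {M} w = dense⁻ w (surround (suc (suc M)) w) λ v≤ →
  trans (count≤-∷ {w = w ∷ʳ suc (suc M)} (s≤s v≤)) (count≤-∷ʳ w (s≤s v≤))

length-both : ∀ w → Shape (suc M) j h (surround (suc (suc M)) w) → length w ≡ M + h
length-both w s = suc-injective (trans (sym (length-∷ʳ w)) (suc-injective (Shape.length≡ s)))

unshape-both : All (_≤ suc M) w → Shape (suc M) j (suc h) (surround (suc (suc M)) w) → Shape M j h w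
unshape-both {M} {[]} w≤ s = contradiction (dense⇒length [] (dense-both [] (Shape.dense s))) λ ()
unshape-both {M} {w@(y ∷ u)} {j} {h} w≤ s = shape
  (valley-∷ʳ⁻ w (valley-tail valley)) (proj₁ (All.∷ʳ⁻ (All.tail positive))) w≤ (dense-both w dense)
  (trans (length-both w s) (+-suc M h))
  (trans (sym (des-∷ʳ (All.map s≤s w≤)))
    (suc-injective (trans (sym (des-falling (u ∷ʳ _) (s≤s (All.head w≤)))) (trans des≡ (+-suc j h)))))
  where open Shape s

-- For `j = 0` nothing is missing from R, so M + 2 must stand at the right end. Numerically,
-- `valley-length` leaves room for one letter fewer than the length requires.
missing-none : Shape (suc M) 0 h w → ¬ All (_≤ suc M) w
missing-none {M} {h} {w} s w≤ = <-irrefl refl (begin-strict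
  suc M + h       <⟨ ≤-refl ⟩
  2 + M + h       ≡⟨ length≡ ⟨
  length w        ≤⟨ valley-length positive w≤ valley ⟩
  suc M + des w   ≡⟨ cong (suc M +_) des≡ ⟩
  suc M + h       ∎)
  where open Shape s ; open ≤-Reasoning

missing-left : Shape (suc M) 0 h (suc (suc M) ∷ w) → ¬ All (_≤ suc M) w
missing-left {M} {w = []} s _ = contradiction (dense⇒length (suc (suc M) ∷ []) (Shape.dense s)) λ { (s≤s ()) }
missing-left {M} {h} {w@(y ∷ u)} s w≤ = <-irrefl refl (begin-strict
  suc M + h             ≡⟨ suc-injective length≡ ⟨
  length w              ≤⟨ valley-length (All.tail positive) w≤ (valley-tail valley) ⟩
  suc M + des w         <⟨ +-monoʳ-< (suc M) ≤-refl ⟩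
  suc M + suc (des w)   ≡⟨ cong (suc M +_) (trans (sym (des-falling u (s≤s (All.head w≤)))) des≡) ⟩
  suc M + h             ∎)
  where open Shape s ; open ≤-Reasoning

complete : ∀ M j h → Shape M j h w → w ∈ gen M j h
complete zero j h (shape (rising []) _ _ _ () _)
complete zero zero zero (shape (rising [-]) (s≤s z≤n ∷ []) (s≤s z≤n ∷ []) _ _ _) = here refl
complete zero zero (suc h) (shape (rising [-]) _ _ _ _ ())
complete zero (suc j) h (shape (rising [-]) _ _ _ _ ())
complete zero _ _ (shape (rising (x<y ∷ _)) (1≤x ∷ _) (_ ∷ y≤1 ∷ _) _ _ _) =
  contradiction (≤-trans y≤1 1≤x) (<⇒≱ x<y)
complete zero _ _ (shape (falling y<x _) (_ ∷ 1≤y ∷ _) (x≤1 ∷ _) _ _ _) =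
  contradiction (≤-trans x≤1 1≤y) (<⇒≱ y<x)
complete (suc M) j h s = go j h s (peel (Shape.bounded s) (Shape.valley s))
  where
  open Extend (suc (suc M)) (gen M)
  go : ∀ {w} j h → Shape (suc M) j h w → Peel (suc M) w → w ∈ extend j h
  go zero    h       s (none w≤)  = contradiction w≤ (missing-none s)
  go (suc j) h       s (none w≤)  =
    ∈-++⁺ˡ (∈-++⁺ʳ (rights (suc j) h) (complete M j (suc h) (unshape-none w≤ s)))
  go j       h       s (right w≤) =
    ∈-++⁺ˡ (∈-++⁺ˡ (∈-map⁺ (append _) (complete M j h (unshape-right w≤ s))))
  go zero    h       s (left w≤)  = contradiction w≤ (missing-left s)
  go (suc j) h       s (left w≤)  = ∈-++⁺ʳ (rights (suc j) h ++ nones (suc j) h)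
    (∈-++⁺ʳ (boths (suc j) h) (∈-map⁺ (prepend _) (complete M j h (unshape-left w≤ s))))
  -- `both` raises the height, so it would have started from -1: the inner word has `M` letters
  -- where density asks for M + 1.
  go j       zero    s (both {w} w≤)  = contradiction (dense⇒length w (dense-both w (Shape.dense s)))
    (<⇒≱ (s≤s (≤-reflexive (trans (length-both w s) (+-identityʳ M)))))
  go j       (suc h) s (both w≤)  = ∈-++⁺ʳ (rights j (suc h) ++ nones j (suc h))
    (∈-++⁺ˡ (∈-map⁺ (surround _) (complete M j h (unshape-both w≤ s))))

-- Absence of repetitions

last-∷ʳ : ∀ (w : Word) → last (w ∷ʳ x) ≡ just x
last-∷ʳ []          = refl
last-∷ʳ (_ ∷ [])    = refl
last-∷ʳ (_ ∷ z ∷ w) = last-∷ʳ (z ∷ w)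

last-≢ : All (_< x) w → last w ≢ just x
last-≢ (y<x ∷ [])        eq = <⇒≢ y<x (just-injective eq)
last-≢ (_ ∷ w<x@(_ ∷ _)) eq = last-≢ w<x eq

head-≢ : All (_< x) w → head w ≢ just x
head-≢ (y<x ∷ _) eq = <⇒≢ y<x (just-injective eq)

disjoint : {Q : Word → Set} {ws us : List Word} → All Q ws → All (¬_ ∘ Q) us → Disjoint ws us
disjoint qs ¬qs (∈ws , ∈us) = All.lookup ¬qs ∈us (All.lookup qs ∈ws)

delay-unique : ∀ f k → (∀ i → k ≡ suc i → Unique (f i)) → Unique (delay f k)
delay-unique f zero    u = []
delay-unique f (suc k) u = u k refl

-- Within a block the added letters cancel. Between blocks, the first or the last letter decides, as
-- the shorter words have all letters below `top`.
gen-unique : ∀ M j h → Unique (gen M j h)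
gen-unique zero    zero    zero    = [] ∷ []
gen-unique zero    zero    (suc _) = []
gen-unique zero    (suc _) _       = []
gen-unique (suc M) j       h       = Unique.++⁺
  (Unique.++⁺
    (Unique.map⁺ (∷ʳ-injectiveˡ _ _) (gen-unique M j h))
    (delay-unique _ j λ i _ → gen-unique M i (suc h))
    (disjoint {λ w → last w ≡ just top}
      (All.map⁺ (All.universal last-∷ʳ _))
      (delay-all _ j λ i _ → All.map (last-≢ ∘ Shape.bounded<) (gen-sound M i (suc h)))))
  (Unique.++⁺
    (delay-unique _ h λ l _ → Unique.map⁺ (∷ʳ-injectiveˡ _ _ ∘ ∷-injectiveʳ) (gen-unique M j l))
    (delay-unique _ j λ i _ → Unique.map⁺ ∷-injectiveʳ (gen-unique M i h))
    (disjoint {λ w → last w ≡ just top}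
      (delay-all _ h λ l _ → All.map⁺ (All.universal (last-∷ʳ ∘ (top ∷_)) _))
      (delay-all _ j λ i _ → All.map⁺ (All.map last-left (gen-sound M i h)))))
  (λ (∈ₗ , ∈ᵣ) → disjoint {λ w → head w ≡ just top}
    (All.++⁺
      (delay-all _ h λ l _ → All.map⁺ (All.universal (λ _ → refl) _))
      (delay-all _ j λ i _ → All.map⁺ (All.universal (λ _ → refl) _)))
    (All.++⁺
      (All.map⁺ (All.map head-right (gen-sound M j h)))
      (delay-all _ j λ i _ → All.map (head-≢ ∘ Shape.bounded<) (gen-sound M i (suc h))))
    (∈ᵣ , ∈ₗ))
  where
  top = suc (suc M)
  last-left : ∀ {j h w} → Shape M j h w → last (top ∷ w) ≢ just top
  -- From the empty word one would get a single `top`, which is both first and last.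
  last-left {w = []}    s = contradiction (Shape.length≡ s) λ ()
  last-left {w = _ ∷ _} s = last-≢ (Shape.bounded< s)
  head-right : ∀ {j h w} → Shape M j h w → head (w ∷ʳ top) ≢ just top
  head-right {w = []}    s = contradiction (Shape.length≡ s) λ ()
  head-right {w = _ ∷ _} s eq = head-≢ (Shape.bounded< s) eq

-- Counting by reflection

-- With the lower index shifted to k − 1, Pascal's rule needs no case distinction at index 0.
C₋₁ : ℕ → ℕ → ℕ
C₋₁ M zero    = 0
C₋₁ M (suc k) = M C k

pascal : ∀ M k → C₋₁ (suc M) (suc k) ≡ C₋₁ M k + C₋₁ M (suc k)
pascal M zero    = refl
pascal M (suc k) = sym (nCk+nC[k+1]≡[n+1]C[k+1] M k)

length-++₄ : ∀ {A : Set} (as bs cs ds : List A) →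
  length ((as ++ bs) ++ (cs ++ ds)) ≡ (length as + length bs) + (length cs + length ds)
length-++₄ as bs cs ds = trans (length-++ (as ++ bs)) (cong₂ _+_ (length-++ as) (length-++ cs))

-- Here `p`, `q`, `r` are the values of `C₋₁ M` at j + h and the next two indices, `x`, `y`, `z`
-- those at j - 1, j, j + 1, and `a`, `b`, `c`, `d` the sizes of `rights`, `nones`, `boths`,
-- `lefts`. The four differences of products add up to one difference with Pascal's rule in every
-- factor; negative terms are moved across to stay in ℕ.
reflection-step : ∀ a b c d p q r x y z →
  a + r * y ≡ q * z → b + r * x ≡ q * y → c + q * y ≡ p * z → d + q * x ≡ p * y →
  (a + b) + (c + d) + (q + r) * (x + y) ≡ (p + q) * (y + z)
reflection-step a b c d p q r x y z ea eb ec ed = begin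
  (a + b) + (c + d) + (q + r) * (x + y)                                ≡⟨ left-side a b c d q r x y ⟩
  (a + r * y) + (b + r * x) + ((c + q * y) + (d + q * x))
    ≡⟨ cong₂ _+_ (cong₂ _+_ ea eb) (cong₂ _+_ ec ed) ⟩
  q * z + q * y + (p * z + p * y)                                      ≡⟨ right-side p q y z ⟩
  (p + q) * (y + z)                                                    ∎
  where
  open ≡-Reasoning
  left-side : ∀ a b c d q r x y → (a + b) + (c + d) + (q + r) * (x + y)
                                  ≡ (a + r * y) + (b + r * x) + ((c + q * y) + (d + q * x))
  left-side = solve-∀
  right-side : ∀ p q y z → q * z + q * y + (p * z + p * y) ≡ (p + q) * (y + z)
  right-side = solve-∀

-- The reflection principle: the difference of the two products satisfies the recursion of
-- gen, and it vanishes on the boundary h = −1.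
length-gen : ∀ M j h →
  length (gen M j h) + C₋₁ M (2 + (j + h)) * C₋₁ M j ≡ C₋₁ M (1 + (j + h)) * C₋₁ M (1 + j)
length-gen zero    zero    zero    = refl
length-gen zero    zero    (suc _) = refl
length-gen zero    (suc _) _       = refl
length-gen (suc M) j h = begin
  length (gen (suc M) j h) + C₋₁ (suc M) (2 + (j + h)) * C₋₁ (suc M) j
    ≡⟨ cong₂ _+_ (length-++₄ (rights j h) (nones j h) (boths j h) (lefts j h))
         (cong (_* C₋₁ (suc M) j) (pascal M (1 + (j + h)))) ⟩
  (length (rights j h) + length (nones j h)) + (length (boths j h) + length (lefts j h))
    + (C₋₁ M (1 + (j + h)) + C₋₁ M (2 + (j + h))) * C₋₁ (suc M) j
    ≡⟨ step j ⟩
  (C₋₁ M (j + h) + C₋₁ M (1 + (j + h))) * (C₋₁ M j + C₋₁ M (1 + j))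
    ≡⟨ cong₂ _*_ (pascal M (j + h)) (pascal M j) ⟨
  C₋₁ (suc M) (1 + (j + h)) * C₋₁ (suc M) (1 + j) ∎
  where
  open ≡-Reasoning
  open Extend (suc (suc M)) (gen M)

  length-rights : ∀ j h → length (rights j h) + C₋₁ M (2 + (j + h)) * C₋₁ M j
                          ≡ C₋₁ M (1 + (j + h)) * C₋₁ M (1 + j)
  length-rights j h =
    trans (cong (_+ C₋₁ M (2 + (j + h)) * C₋₁ M j) (length-map (append _) (gen M j h)))
      (length-gen M j h)

  length-boths : ∀ j h → length (boths j h) + C₋₁ M (1 + (j + h)) * C₋₁ M j
                         ≡ C₋₁ M (j + h) * C₋₁ M (1 + j)
  -- The block is empty, and the two products at h = -1 differ only in the order of their factors.
  length-boths j zero    rewrite +-identityʳ j = *-comm (C₋₁ M (1 + j)) (C₋₁ M j)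
  length-boths j (suc h) rewrite +-suc j h =
    trans (cong (_+ C₋₁ M (2 + (j + h)) * C₋₁ M j) (length-map (surround _) (gen M j h)))
      (length-gen M j h)

  step : ∀ j → (length (rights j h) + length (nones j h)) + (length (boths j h) + length (lefts j h))
             + (C₋₁ M (1 + (j + h)) + C₋₁ M (2 + (j + h))) * C₋₁ (suc M) j
           ≡ (C₋₁ M (j + h) + C₋₁ M (1 + (j + h))) * (C₋₁ M j + C₋₁ M (1 + j))
  -- For `j = 0`, `nones` and `lefts` are empty, and `x`, `y` are binomial coefficients with lower
  -- indices -2 and -1.
  step zero = reflection-step _ 0 (length (boths 0 h)) 0
    (C₋₁ M h) (C₋₁ M (1 + h)) (C₋₁ M (2 + h)) 0 0 (C₋₁ M 1)
    (length-rights 0 h) (trans (*-zeroʳ (C₋₁ M (2 + h))) (sym (*-zeroʳ (C₋₁ M (1 + h)))))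
    (length-boths 0 h) (trans (*-zeroʳ (C₋₁ M (1 + h))) (sym (*-zeroʳ (C₋₁ M h))))
  step (suc i) rewrite pascal M i = reflection-step _ (length (gen M i (suc h))) (length (boths (suc i) h)) _
    (C₋₁ M (suc i + h)) (C₋₁ M (2 + (i + h))) (C₋₁ M (3 + (i + h)))
    (C₋₁ M i) (C₋₁ M (1 + i)) (C₋₁ M (2 + i))
    (length-rights (suc i) h)
    (subst (λ m → length (gen M i (suc h)) + C₋₁ M (2 + m) * C₋₁ M i ≡ C₋₁ M (1 + m) * C₋₁ M (1 + i))
      (+-suc i h)
      (length-gen M i (suc h)))
    (length-boths (suc i) h)
    (trans (cong (_+ C₋₁ M (2 + (i + h)) * C₋₁ M i) (length-map (prepend _) (gen M i h)))
      (length-gen M i h))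

-- Narayana numbers from the determinant

-- This is (k + 1) C(n, k + 1) = (n - k) C(n, k) freed of the subtraction, so that it holds for all
-- `k` and passes through Pascal's rule.
absorption : ∀ n k → suc k * (n C suc k) + k * (n C k) ≡ n * (n C k)
absorption n       zero    = trans (cong (λ m → 1 * m + 0) (nC1≡n n))
  (trans (+-identityʳ (1 * n)) (trans (*-identityˡ n) (sym (*-identityʳ n))))
absorption zero    (suc k) = cong₂ _+_ (*-zeroʳ (suc (suc k))) (*-zeroʳ (suc k))
absorption (suc n) (suc k) = begin
  suc (suc k) * (suc n C suc (suc k)) + suc k * (suc n C suc k)
    ≡⟨ cong₂ (λ p q → suc (suc k) * p + suc k * q) (pascal n (2 + k)) (pascal n (1 + k)) ⟩
  suc (suc k) * (n C suc k + n C (2 + k)) + suc k * (n C k + n C suc k)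
    ≡⟨ left-side k (n C k) (n C suc k) (n C (2 + k)) ⟩
  (suc (suc k) * (n C (2 + k)) + suc k * (n C suc k)) + (suc k * (n C suc k) + k * (n C k)) + (n C k + n C suc k)
    ≡⟨ cong (_+ (n C k + n C suc k)) (cong₂ _+_ (absorption n (suc k)) (absorption n k)) ⟩
  n * (n C suc k) + n * (n C k) + (n C k + n C suc k)
    ≡⟨ right-side n (n C k) (n C suc k) ⟩
  suc n * (n C k + n C suc k)
    ≡⟨ cong (suc n *_) (pascal n (1 + k)) ⟨
  suc n * (suc n C suc k) ∎
  where
  open ≡-Reasoning
  left-side : ∀ k x y z → suc (suc k) * (y + z) + suc k * (x + y)
                          ≡ (suc (suc k) * z + suc k * y) + (suc k * y + k * x) + (x + y)
  left-side = solve-∀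
  right-side : ∀ n x y → n * y + n * x + (x + y) ≡ suc n * (x + y)
  right-side = solve-∀

-- To be read with x, y, z = M C l, M C (1 + l), M C (2 + l).
narayana-identity : ∀ M l x y z →
  (2 + l) * z + (1 + l) * y ≡ M * y → (1 + l) * y + l * x ≡ M * x →
  suc M * (y * y) ≡ (x + y) * (y + z) + suc M * (z * x)
-- The relations can be applied only to complete sums. The extra `l * (x * y)` completes
-- `y * ((1 + l) * y + l * x)` and is left over again once `ez` and `ey` have been used twice each.
narayana-identity M l x y z ez ey = +-cancelʳ-≡ (l * (x * y)) _ _ (begin
  suc M * (y * y) + l * (x * y)                                   ≡⟨ s₁ M l x y ⟩
  M * y * y + y * y + l * (x * y)
    ≡⟨ cong (λ m → m * y + y * y + l * (x * y)) ez ⟨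
  ((2 + l) * z + (1 + l) * y) * y + y * y + l * (x * y)           ≡⟨ s₂ l x y z ⟩
  (2 + l) * (y * z) + y * y + y * ((1 + l) * y + l * x)
    ≡⟨ cong (λ m → (2 + l) * (y * z) + y * y + y * m) ey ⟩
  (2 + l) * (y * z) + y * y + y * (M * x)                         ≡⟨ s₃ M l x y z ⟩
  (2 + l) * (y * z) + y * y + x * (M * y)
    ≡⟨ cong (λ m → (2 + l) * (y * z) + y * y + x * m) ez ⟨
  (2 + l) * (y * z) + y * y + x * ((2 + l) * z + (1 + l) * y)     ≡⟨ s₄ l x y z ⟩
  (x + y) * (y + z) + z * (((1 + l) * y + l * x) + x) + l * (x * y)
    ≡⟨ cong (λ m → (x + y) * (y + z) + z * (m + x) + l * (x * y)) ey ⟩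
  (x + y) * (y + z) + z * (M * x + x) + l * (x * y)               ≡⟨ s₅ M l x y z ⟩
  (x + y) * (y + z) + suc M * (z * x) + l * (x * y)               ∎)
  where
  open ≡-Reasoning
  s₁ : ∀ M l x y → suc M * (y * y) + l * (x * y) ≡ M * y * y + y * y + l * (x * y)
  s₁ = solve-∀
  s₂ : ∀ l x y z → ((2 + l) * z + (1 + l) * y) * y + y * y + l * (x * y)
     ≡ (2 + l) * (y * z) + y * y + y * ((1 + l) * y + l * x)
  s₂ = solve-∀
  s₃ : ∀ M l x y z → (2 + l) * (y * z) + y * y + y * (M * x)
     ≡ (2 + l) * (y * z) + y * y + x * (M * y)
  s₃ = solve-∀
  s₄ : ∀ l x y z → (2 + l) * (y * z) + y * y + x * ((2 + l) * z + (1 + l) * y)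
     ≡ (x + y) * (y + z) + z * (((1 + l) * y + l * x) + x) + l * (x * y)
  s₄ = solve-∀
  s₅ : ∀ M l x y z → (x + y) * (y + z) + z * (M * x + x) + l * (x * y)
     ≡ (x + y) * (y + z) + suc M * (z * x) + l * (x * y)
  s₅ = solve-∀

narayana : ∀ M k → suc M * length (gen M k 0) ≡ (suc M C k) * (suc M C suc k)
narayana M k = +-cancelʳ-≡ (suc M * (C₋₁ M (2 + k) * C₋₁ M k)) _ _ (begin
  suc M * length (gen M k 0) + suc M * (C₋₁ M (2 + k) * C₋₁ M k)
    ≡⟨ *-distribˡ-+ (suc M) (length (gen M k 0)) _ ⟨
  suc M * (length (gen M k 0) + C₋₁ M (2 + k) * C₋₁ M k)
    ≡⟨ cong (suc M *_) ballot ⟩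
  suc M * (C₋₁ M (1 + k) * C₋₁ M (1 + k))
    ≡⟨ identity k ⟩
  (C₋₁ M k + C₋₁ M (1 + k)) * (C₋₁ M (1 + k) + C₋₁ M (2 + k)) + suc M * (C₋₁ M (2 + k) * C₋₁ M k)
    ≡⟨ cong (_+ suc M * (C₋₁ M (2 + k) * C₋₁ M k)) (cong₂ _*_ (pascal M k) (pascal M (1 + k))) ⟨
  (suc M C k) * (suc M C suc k) + suc M * (C₋₁ M (2 + k) * C₋₁ M k) ∎)
  where
  open ≡-Reasoning
  ballot : length (gen M k 0) + C₋₁ M (2 + k) * C₋₁ M k ≡ C₋₁ M (1 + k) * C₋₁ M (1 + k)
  ballot = subst (λ m → length (gen M k 0) + C₋₁ M (2 + m) * C₋₁ M k ≡ C₋₁ M (1 + m) * C₋₁ M (1 + k))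
    (+-identityʳ k) (length-gen M k 0)
  base : ∀ m → suc m * 1 ≡ 1 * (1 + m) + suc m * (m * 0)
  base = solve-∀
  identity : ∀ k → suc M * (C₋₁ M (1 + k) * C₋₁ M (1 + k)) ≡
    (C₋₁ M k + C₋₁ M (1 + k)) * (C₋₁ M (1 + k) + C₋₁ M (2 + k)) + suc M * (C₋₁ M (2 + k) * C₋₁ M k)
  -- Absorption has no instance at lower index -1; the coefficients are 0, 1 and `M`.
  identity zero rewrite nC1≡n M = base M
  identity (suc l) = narayana-identity M l (M C l) (M C suc l) (M C (2 + l)) (absorption M (suc l)) (absorption M l)

-- Parking functions as dense words

words-unique : ∀ k n → Unique (words k n)
words-unique zero    n = [] ∷ []
words-unique (suc k) n = Unique.cartesianProductWith⁺ _∷_ ∷-injective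
  (Unique.applyUpTo⁺₁ suc n λ i<j _ eq → <⇒≢ i<j (suc-injective eq)) (words-unique k n)

∈-words⁺ : ∀ w → All (1 ≤_) w → All (_≤ n) w → w ∈ words (length w) n
∈-words⁺ [] _ _ = here refl
∈-words⁺ (suc x ∷ w) (_ ∷ 1≤w) (x<n ∷ w≤n) =
  ∈-cartesianProductWith⁺ _∷_ (∈-applyUpTo⁺ suc x<n) (∈-words⁺ w 1≤w w≤n)

∈-words⁻ : ∀ k → w ∈ words k n → length w ≡ k × All (1 ≤_) w × All (_≤ n) w
∈-words⁻ zero (here refl) = refl , [] , []
∈-words⁻ {n = n} (suc k) w∈ with ∈-cartesianProductWith⁻ _∷_ [ n ] (words k n) w∈
... | _ , u , x∈ , u∈ , refl with ∈-applyUpTo⁻ suc x∈ | ∈-words⁻ k u∈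
...   | _ , x<n , refl | len , 1≤u , u≤n = cong suc len , z<s ∷ 1≤u , x<n ∷ u≤n

-- The offset `c` counts the letters already stripped from the front, so that the hypothesis passes
-- to tails.
count≤-lower : ∀ c v b → (∀ i → lookup b i ≤ suc (c + toℕ i)) → v ≤ length b → v ≤ count≤ (c + v) b
count≤-lower c zero    b       _    _        = z≤n
count≤-lower c (suc v) (x ∷ b) bᵢ≤i (s≤s v≤) = begin
  suc v
    ≤⟨ s≤s (count≤-lower (suc c) v b tail≤ v≤) ⟩
  suc (count≤ (suc c + v) b)       ≡⟨ cong (λ m → suc (count≤ m b)) (+-suc c v) ⟨
  suc (count≤ (c + suc v) b)       ≡⟨ cong length (filter-accept (_≤? (c + suc v)) x≤) ⟨
  count≤ (c + suc v) (x ∷ b)       ∎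
  where
  open ≤-Reasoning
  tail≤ : ∀ i → lookup b i ≤ suc (suc c + toℕ i)
  tail≤ i = subst (λ m → lookup b i ≤ suc m) (+-suc c (toℕ i)) (bᵢ≤i (suc i))
  x≤ : x ≤ c + suc v
  x≤ = ≤-trans (bᵢ≤i zero) (subst (_≤ c + suc v) (+-suc c 0) (+-monoʳ-≤ c z<s))

-- By sortedness all letters from position `i` on exceed `v`; only those before it can count.
count≤-upper : ∀ b → AllPairs _≤_ b → ∀ i → v < lookup b i → count≤ v b ≤ toℕ i
count≤-upper {v} (x ∷ b) (x≤b ∷ _) zero v<x =
  ≤-reflexive (cong length (filter-none (_≤? v) (All.map <⇒≱ (v<x ∷ All.map (<-≤-trans v<x) x≤b))))
count≤-upper {v} (x ∷ b) (_ ∷ b↗) (suc i) v< = begin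
  count≤ v (x ∷ b)                     ≤⟨ count≤-∷-≤ ⟩
  suc (count≤ v b)                     ≤⟨ s≤s (count≤-upper b b↗ i v<) ⟩
  suc (toℕ i)                          ∎
  where
  open ≤-Reasoning
  count≤-∷-≤ : count≤ v (x ∷ b) ≤ suc (count≤ v b)
  count≤-∷-≤ with x ≤? v
  ... | yes x≤v = ≤-reflexive (cong length (filter-accept (_≤? v) x≤v))
  ... | no  x≰v = ≤-trans (≤-reflexive (cong length (filter-reject (_≤? v) x≰v))) (n≤1+n _)

parking⇒dense : ∀ w → Parking w → length w ≡ suc M → Dense M w
parking⇒dense w parking len v≤ = subst (_ ≤_) (count≤-↭ (sort-↭ w))
  (count≤-lower 0 _ (sort w) parking (subst (_ ≤_) (sym (trans (↭-length (sort-↭ w)) len)) v≤))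

dense⇒parking : ∀ w → Dense M w → length w ≡ suc M → Parking w
-- If the entry at `i` exceeds `suc (toℕ i)`, then at this threshold density and sortedness disagree
-- by one.
dense⇒parking {M} w dense len i = ≮⇒≥ λ i< → <-irrefl refl (begin-strict
  toℕ i                       <⟨ dense (subst (toℕ i <_) (trans (↭-length (sort-↭ w)) len) (toℕ<n i)) ⟩
  count≤ (suc (toℕ i)) w      ≡⟨ count≤-↭ (sort-↭ w) ⟨
  count≤ (suc (toℕ i)) (sort w)
    ≤⟨ count≤-upper (sort w) (Linked.Linked⇒AllPairs ≤-trans (sort-↗ w)) i i< ⟩
  toℕ i                       ∎)
  where open ≤-Reasoning

valleyPF : ℕ → List Word
valleyPF n = filter peakAndTieFree? (PF n)

des-filter↭gen : ∀ M k → filter (λ w → des w ≟ k) (valleyPF (suc M)) ↭ gen M k 0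
des-filter↭gen M k = ∼bag⇒↭ (unique∧set⇒bag
  (Unique.filter⁺ _ (Unique.filter⁺ _ (Unique.filter⁺ _ (words-unique (suc M) (suc M)))))
  (gen-unique M k 0)
  (mk⇔ to from))
  where
  to : w ∈ filter (λ w → des w ≟ k) (valleyPF (suc M)) → w ∈ gen M k 0
  to {w} w∈ with ∈-filter⁻ (λ w → des w ≟ k) {xs = valleyPF (suc M)} w∈
  ... | w∈₁ , des≡ with ∈-filter⁻ peakAndTieFree? {xs = PF (suc M)} w∈₁
  ...   | w∈₂ , free with ∈-filter⁻ parking? {xs = words (suc M) (suc M)} w∈₂
  ...     | w∈₃ , parking with ∈-words⁻ (suc M) w∈₃
  ...       | len , 1≤w , w≤ = complete M k 0 (shape (valley⁺ w free) 1≤w w≤ (parking⇒dense w parking len)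
                (trans len (sym (+-identityʳ _))) (trans des≡ (sym (+-identityʳ _))))
  from : w ∈ gen M k 0 → w ∈ filter (λ w → des w ≟ k) (valleyPF (suc M))
  from {w} w∈ = ∈-filter⁺ (λ w → des w ≟ k)
    (∈-filter⁺ peakAndTieFree?
      (∈-filter⁺ parking? (subst (λ m → w ∈ words m (suc M)) len (∈-words⁺ w positive bounded))
        (dense⇒parking w dense len))
      (valley⁻ valley))
    (trans des≡ (+-identityʳ k))
    where
    open Shape (All.lookup (gen-sound M k 0) w∈)
    len : length w ≡ suc M
    len = trans length≡ (+-identityʳ _)

-- Coefficients of the two polynomials

open import Data.Integer.Base as ℤ using (+_)
import Data.Integer.Properties as ℤ
open import Data.Rational.Base as ℚ using (ℚ; 0ℚ; 1ℚ; _/_; toℚᵘ)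
import Data.Rational.Properties as ℚ
open import Data.Rational.Unnormalised.Base as ℚᵘ using (mkℚᵘ; *≡*)
import Data.Rational.Unnormalised.Properties as ℚᵘ

-- Normalisation by a gcd does not compute on variables; with unnormalised fractions an equation
-- becomes integer cross-multiplication.
toℚᵘ-/ : ∀ i n → toℚᵘ (i / suc n) ℚᵘ.≃ mkℚᵘ i n
toℚᵘ-/ i n = ℚ.toℚᵘ-fromℚᵘ (mkℚᵘ i n)

/1-suc : ∀ m → 1ℚ ℚ.+ + m / 1 ≡ + suc m / 1
/1-suc m = ℚ.toℚᵘ-injective (begin
  toℚᵘ (1ℚ ℚ.+ + m / 1)         ≈⟨ ℚ.toℚᵘ-homo-+ 1ℚ (+ m / 1) ⟩
  toℚᵘ 1ℚ ℚᵘ.+ toℚᵘ (+ m / 1)   ≈⟨ ℚᵘ.+-congʳ (toℚᵘ 1ℚ) (toℚᵘ-/ (+ m) 0) ⟩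
  mkℚᵘ (+ 1) 0 ℚᵘ.+ mkℚᵘ (+ m) 0 ≈⟨ *≡* (cong (λ i → (+ 1 ℤ.+ i) ℤ.* + 1) (ℤ.*-identityʳ (+ m))) ⟩
  mkℚᵘ (+ suc m) 0              ≈⟨ toℚᵘ-/ (+ suc m) 0 ⟨
  toℚᵘ (+ suc m / 1)            ∎)
  where open ℚᵘ.≃-Reasoning

/-*-* : ∀ n a b c → suc n * c ≡ a * b → + c / 1 ≡ + 1 / suc n ℚ.* (+ a / 1) ℚ.* (+ b / 1)
/-*-* n a b c eq = ℚ.toℚᵘ-injective (begin
  toℚᵘ (+ c / 1)                                                    ≈⟨ toℚᵘ-/ (+ c) 0 ⟩
  mkℚᵘ (+ c) 0                                                      ≈⟨ *≡* cross ⟩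
  mkℚᵘ (+ 1) n ℚᵘ.* mkℚᵘ (+ a) 0 ℚᵘ.* mkℚᵘ (+ b) 0
    ≈⟨ ℚᵘ.*-cong (ℚᵘ.*-cong (toℚᵘ-/ (+ 1) n) (toℚᵘ-/ (+ a) 0)) (toℚᵘ-/ (+ b) 0) ⟨
  toℚᵘ (+ 1 / suc n) ℚᵘ.* toℚᵘ (+ a / 1) ℚᵘ.* toℚᵘ (+ b / 1)
    ≈⟨ ℚᵘ.*-congʳ (ℚ.toℚᵘ-homo-* (+ 1 / suc n) (+ a / 1)) ⟨
  toℚᵘ (+ 1 / suc n ℚ.* (+ a / 1)) ℚᵘ.* toℚᵘ (+ b / 1)
    ≈⟨ ℚ.toℚᵘ-homo-* (+ 1 / suc n ℚ.* (+ a / 1)) (+ b / 1) ⟨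
  toℚᵘ (+ 1 / suc n ℚ.* (+ a / 1) ℚ.* (+ b / 1))                    ∎)
  where
  open ℚᵘ.≃-Reasoning
  left-side : ∀ n c → c * (suc n * 1 * 1) ≡ suc n * c
  left-side = solve-∀
  right-side : ∀ a b → a * b ≡ 1 * a * b * 1
  right-side = solve-∀
  cross : + c ℤ.* + (suc n * 1 * 1) ≡ + 1 ℤ.* + a ℤ.* + b ℤ.* + 1
  cross = trans (sym (ℤ.pos-* c (suc n * 1 * 1)))
    (trans (cong +_ (trans (left-side n c) (trans eq (right-side a b))))
    (trans (ℤ.pos-* (1 * a * b) 1) (cong (ℤ._* + 1)
    (trans (ℤ.pos-* (1 * a) b) (cong (ℤ._* + b) (ℤ.pos-* 1 a))))))

coeff-⊕ : ∀ p q k → coeff (p ⊕ q) k ≡ coeff p k ℚ.+ coeff q k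
coeff-⊕ []      q       k       = sym (ℚ.+-identityˡ _)
coeff-⊕ (_ ∷ _) []      k       = sym (ℚ.+-identityʳ _)
coeff-⊕ (_ ∷ _) (_ ∷ _) zero    = refl
coeff-⊕ (_ ∷ p) (_ ∷ q) (suc k) = coeff-⊕ p q k

coeff-·t^-≡ : ∀ c d → coeff (c ·t^ d) d ≡ c
coeff-·t^-≡ c zero    = refl
coeff-·t^-≡ c (suc d) = coeff-·t^-≡ c d

coeff-·t^-≢ : ∀ c {d k} → d ≢ k → coeff (c ·t^ d) k ≡ 0ℚ
coeff-·t^-≢ c {zero}  {zero}  d≢k = contradiction refl d≢k
coeff-·t^-≢ c {zero}  {suc k} d≢k = refl
coeff-·t^-≢ c {suc d} {zero}  d≢k = refl
coeff-·t^-≢ c {suc d} {suc k} d≢k = coeff-·t^-≢ c (d≢k ∘ cong suc)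

coeff-∑-count : ∀ {A : Set} (e : A → ℕ) k xs →
  coeff (∑ xs (λ x → 1ℚ ·t^ e x)) k ≡ + length (filter (λ x → e x ≟ k) xs) / 1
coeff-∑-count e k []       = refl
coeff-∑-count e k (x ∷ xs) with e x ≟ k
... | yes refl = begin
  coeff (1ℚ ·t^ e x ⊕ ∑ xs _) k                                  ≡⟨ coeff-⊕ (1ℚ ·t^ e x) _ k ⟩
  coeff (1ℚ ·t^ e x) k ℚ.+ coeff (∑ xs _) k
    ≡⟨ cong₂ ℚ._+_ (coeff-·t^-≡ 1ℚ k) (coeff-∑-count e k xs) ⟩
  1ℚ ℚ.+ + length (filter (λ x → e x ≟ k) xs) / 1
    ≡⟨ /1-suc (length (filter (λ x → e x ≟ k) xs)) ⟩
  + suc (length (filter (λ x → e x ≟ k) xs)) / 1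
    ≡⟨ cong (λ l → + length l / 1) (filter-accept (λ x → e x ≟ k) {xs = xs} refl) ⟨
  + length (filter (λ x → e x ≟ k) (x ∷ xs)) / 1                 ∎
  where open ≡-Reasoning
... | no ≢k = begin
  coeff (1ℚ ·t^ e x ⊕ ∑ xs _) k                                  ≡⟨ coeff-⊕ (1ℚ ·t^ e x) _ k ⟩
  coeff (1ℚ ·t^ e x) k ℚ.+ coeff (∑ xs _) k
    ≡⟨ cong₂ ℚ._+_ (coeff-·t^-≢ 1ℚ ≢k) (coeff-∑-count e k xs) ⟩
  0ℚ ℚ.+ + length (filter (λ x → e x ≟ k) xs) / 1                ≡⟨ ℚ.+-identityˡ _ ⟩
  + length (filter (λ x → e x ≟ k) xs) / 1
    ≡⟨ cong (λ l → + length l / 1) (filter-reject (λ x → e x ≟ k) {xs = xs} ≢k) ⟨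
  + length (filter (λ x → e x ≟ k) (x ∷ xs)) / 1                 ∎
  where open ≡-Reasoning

∑-∷ʳ : ∀ {A : Set} (f : A → ℚ[t]) xs x k → coeff (∑ (xs ∷ʳ x) f) k ≡ coeff (∑ xs f) k ℚ.+ coeff (f x) k
∑-∷ʳ f []       x k = trans (coeff-⊕ (f x) [] k) (ℚ.+-comm (coeff (f x) k) 0ℚ)
∑-∷ʳ f (y ∷ xs) x k = begin
  coeff (f y ⊕ ∑ (xs ∷ʳ x) f) k                              ≡⟨ coeff-⊕ (f y) _ k ⟩
  coeff (f y) k ℚ.+ coeff (∑ (xs ∷ʳ x) f) k
    ≡⟨ cong (coeff (f y) k ℚ.+_) (∑-∷ʳ f xs x k) ⟩
  coeff (f y) k ℚ.+ (coeff (∑ xs f) k ℚ.+ coeff (f x) k)     ≡⟨ ℚ.+-assoc (coeff (f y) k) _ _ ⟨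
  coeff (f y) k ℚ.+ coeff (∑ xs f) k ℚ.+ coeff (f x) k
    ≡⟨ cong (ℚ._+ coeff (f x) k) (coeff-⊕ (f y) _ k) ⟨
  coeff (f y ⊕ ∑ xs f) k ℚ.+ coeff (f x) k                   ∎
  where open ≡-Reasoning

-- Splitting at the last index keeps `f` and the exponents fixed, whereas splitting at the first
-- would shift both.
coeff-∑-upTo-suc : ∀ (f : ℕ → ℚ) n k →
  coeff (∑ (upTo (suc n)) (λ j → f j ·t^ j)) k
    ≡ coeff (∑ (upTo n) (λ j → f j ·t^ j)) k ℚ.+ coeff (f n ·t^ n) k
coeff-∑-upTo-suc f n k =
  trans (cong (λ l → coeff (∑ l (λ j → f j ·t^ j)) k) (sym (upTo-∷ʳ n))) (∑-∷ʳ _ (upTo n) n k)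

coeff-∑-upTo-≥ : ∀ (f : ℕ → ℚ) n → n ≤ k → coeff (∑ (upTo n) (λ j → f j ·t^ j)) k ≡ 0ℚ
coeff-∑-upTo-≥ f zero    _   = refl
coeff-∑-upTo-≥ {k} f (suc n) n<k = trans (coeff-∑-upTo-suc f n k)
  (cong₂ ℚ._+_ (coeff-∑-upTo-≥ f n (<⇒≤ n<k)) (coeff-·t^-≢ (f n) (<⇒≢ n<k)))

coeff-∑-upTo-< : ∀ (f : ℕ → ℚ) n → k < n → coeff (∑ (upTo n) (λ j → f j ·t^ j)) k ≡ f k
coeff-∑-upTo-< {k} f (suc n) k<1+n with m≤n⇒m<n∨m≡n (s≤s⁻¹ k<1+n)
... | inj₁ k<n = trans (coeff-∑-upTo-suc f n k)
  (trans (cong₂ ℚ._+_ (coeff-∑-upTo-< f n k<n) (coeff-·t^-≢ (f n) (>⇒≢ k<n))) (ℚ.+-identityʳ (f k)))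
... | inj₂ refl = trans (coeff-∑-upTo-suc f n k)
  (trans (cong₂ ℚ._+_ (coeff-∑-upTo-≥ f n ≤-refl) (coeff-·t^-≡ (f n) n)) (ℚ.+-identityˡ (f n)))

theorem6p1 : (n : ℕ) .{{_ : NonZero n}} →
    ∑ (filter peakAndTieFree? (PF n)) (λ w → 1ℚ ·t^ des w)
    ≈ ∑ (upTo n) (λ j → (+ 1 / n ℚ.* (+ (n C j) / 1) ℚ.* (+ (n C suc j) / 1)) ·t^ j)
theorem6p1 n@(suc M) k = begin
  coeff (∑ (valleyPF n) (λ w → 1ℚ ·t^ des w)) k              ≡⟨ coeff-∑-count des k (valleyPF n) ⟩
  + length (filter (λ w → des w ≟ k) (valleyPF n)) / 1
    ≡⟨ cong (λ l → + l / 1) (↭-length (des-filter↭gen M k)) ⟩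
  + length (gen M k 0) / 1                                   ≡⟨ rhs ⟩
  coeff (∑ (upTo n) (λ j → f j ·t^ j)) k                     ∎
  where
  open ≡-Reasoning
  f : ℕ → ℚ
  f j = + 1 / n ℚ.* (+ (n C j) / 1) ℚ.* (+ (n C suc j) / 1)
  rhs : + length (gen M k 0) / 1 ≡ coeff (∑ (upTo n) (λ j → f j ·t^ j)) k
  rhs with k <? n
  ... | yes k<n = trans (/-*-* M (n C k) (n C suc k) _ (narayana M k)) (sym (coeff-∑-upTo-< f n k<n))
  -- For k ≥ n the factor `n C suc k` vanishes, so `narayana` itself shows that no word has `k`
  -- descents.
  ... | no  k≮n = trans (cong (λ l → + l / 1) (m*n≡0⇒n≡0 M (trans (narayana M k)
      (trans (cong ((n C k) *_) (k>n⇒nCk≡0 (s≤s (≮⇒≥ k≮n)))) (*-zeroʳ (n C k))))))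
    (sym (coeff-∑-upTo-≥ f n (≮⇒≥ k≮n)))
    where
    m*n≡0⇒n≡0 : ∀ m {l} → suc m * l ≡ 0 → l ≡ 0
    m*n≡0⇒n≡0 m {l} eq = m+n≡0⇒m≡0 l eq
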